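{- Let $r\ge 1$ and let $m_1,\dots,m_r,n$ be positive integers with $m=\sum_{i=1}^r m_i\le n$. Let $$h=\max\Big\{k\in\mathbb{Z},\ k\ge 2:\ \frac{m_i n}{k-1}\ge \Big\lceil \frac{m_i n}{k}\Big\rceil \text{ for all } i\in[r]\Big\}.$$ Then $$\chi_{=}(K_{m_1,\dots,m_r}\times K_n)=\sum_{i=1}^r\Big\lceil \frac{m_i n}{h}\Big\rceil .$$
   Context: All graphs are finite, simple and undirected; $[k]=\{1,\dots,k\}$. A (proper) $k$-coloring of $G$ is a map $f:V(G)\to[k]$ with $f(x)\ne f(y)$ whenever $xy\in E(G)$; its color classes are the sets $f^{ -1}(i)$. An equitable $k$-coloring is a $k$-coloring in which any two color classes differ in size by at most $1$ (equivalently each class has size $\lfloor |V(G)|/k\rfloor$ or $\lceil |V(G)|/k\rceil$); $G$ is equitably $k$-colorable if it has one. The equitable chromatic number $\chi_{=}(G)$ is the minimum $k$ such that $G$ is equitably $k$-colorable. $K_{m_1,\dots,m_r}$ denotes the complete multipartite graph with parts of sizes $m_1,\dots,m_r$, and $K_n$ the complete graph on $n$ vertices. The Kronecker product $G\times H$ has vertex set $V(G)\times V(H)$, with $(x,y)$ adjacent to $(x',y')$ iff $xx'\in E(G)$ and $yy'\in E(H)$. -}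

module Defs where

open import Level using (0ℓ)
open import Data.Nat.Base
open import Data.Nat.Properties using (+-0-commutativeMonoid; m<n⇒0<n; m<n⇒0<n∸m)
open import Data.Integer.Base using (+_; ∣_∣)
import Data.Rational.Unnormalised.Base as ℚᵘ
open import Data.Fin.Base using (Fin; zero; suc)
open import Data.Fin.Properties using (+↔⊎; *↔×; _≟_)
open import Data.List.Base using (List; length; filter; tabulate)
open import Data.Product.Base using (Σ; Σ-syntax; ∃-syntax; _×_; _,_; proj₁; proj₂)
open import Data.Product.Function.NonDependent.Propositional using (_×-↔_)
open import Data.Sum.Base using (_⊎_; inj₁; inj₂)
open import Data.Sum.Function.Propositional using (_⊎-↔_)
open import Function.Base using (_∘_)
open import Function.Bundles using (_↔_; Inverse; mk↔ₛ′)
open import Function.Construct.Composition using (_↔-∘_)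
open import Function.Construct.Identity using (↔-id)
open import Function.Construct.Symmetry using (↔-sym)
open import Relation.Binary.Core using (Rel)
open import Relation.Binary.Definitions using (Symmetric; Irreflexive; Decidable)
open import Relation.Binary.PropositionalEquality using (_≡_; _≢_; refl; sym)
open import Relation.Nullary.Decidable using (¬?; _×-dec_)
open import Relation.Unary using (Pred)

open import Algebra.Properties.CommutativeMonoid.Sum +-0-commutativeMonoid public
  using (sum)

-- Finite simple graphs.  The enumeration only witnesses finiteness: class
-- sizes computed from it do not depend on which one is chosen.
record Graph : Set₁ where
  infix 4 _~_ _~?_
  field
    V      : Set
    order  : ℕ
    enum   : V ↔ Fin order
    _~_    : Rel V 0ℓ
    _~?_   : Decidable _~_
    ~-sym  : Symmetric _~_
    ~-irr  : Irreflexive _≡_ _~_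

  vertices : List V
  vertices = tabulate (Inverse.from enum)

module _ (G : Graph) where
  open Graph G

  IsColoring : ∀ {k} → (V → Fin k) → Set
  IsColoring f = ∀ {x y} → x ~ y → f x ≢ f y

  colorClass : ∀ {k} → (V → Fin k) → Fin k → List V
  colorClass f c = filter (λ v → f v ≟ c) vertices

  IsEquitable : ∀ {k} → (V → Fin k) → Set
  IsEquitable f = ∀ c d → ∣ length (colorClass f c) - length (colorClass f d) ∣ ≤ 1

  EquitablyColorable : Pred ℕ 0ℓ
  EquitablyColorable k = Σ[ f ∈ (V → Fin k) ] IsColoring f × IsEquitable f

IsLeast : Pred ℕ 0ℓ → Pred ℕ 0ℓ
IsLeast P k = P k × (∀ j → P j → k ≤ j)

IsGreatest : Pred ℕ 0ℓ → Pred ℕ 0ℓ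
IsGreatest P k = P k × (∀ j → P j → j ≤ k)

χ₌[_]≡_ : Graph → ℕ → Set
χ₌[ G ]≡ k = IsLeast (EquitablyColorable G) k

Complete : ℕ → Graph
Complete n = record
  { V     = Fin n
  ; order = n
  ; enum  = ↔-id (Fin n)
  ; _~_   = _≢_
  ; _~?_  = λ x y → ¬? (x ≟ y)
  ; ~-sym = λ x≢y y≡x → x≢y (sym y≡x)
  ; ~-irr = λ x≡y x≢y → x≢y x≡y
  }

ΣFin-suc : ∀ {r} (m : Fin (suc r) → ℕ) →
           Σ (Fin (suc r)) (Fin ∘ m) ↔ (Fin (m zero) ⊎ Σ (Fin r) (Fin ∘ m ∘ suc))
ΣFin-suc m = mk↔ₛ′
  (λ { (zero , x) → inj₁ x ; (suc i , x) → inj₂ (i , x) })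
  (λ { (inj₁ x) → zero , x ; (inj₂ (i , x)) → suc i , x })
  (λ { (inj₁ x) → refl ; (inj₂ (i , x)) → refl })
  (λ { (zero , x) → refl ; (suc i , x) → refl })

ΣFin↔sum : ∀ {r} (m : Fin r → ℕ) → Σ (Fin r) (Fin ∘ m) ↔ Fin (sum m)
ΣFin↔sum {zero}  m = mk↔ₛ′ (λ { (() , _) }) (λ ()) (λ ()) (λ { (() , _) })
ΣFin↔sum {suc r} m =
  ↔-sym +↔⊎ ↔-∘ ((↔-id (Fin (m zero)) ⊎-↔ ΣFin↔sum (m ∘ suc)) ↔-∘ ΣFin-suc m)

CompleteMultipartite : ∀ {r} → (Fin r → ℕ) → Graph
CompleteMultipartite {r} m = record
  { V     = Σ[ i ∈ Fin r ] Fin (m i)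
  ; order = sum m
  ; enum  = ΣFin↔sum m
  ; _~_   = λ x y → proj₁ x ≢ proj₁ y
  ; _~?_  = λ x y → ¬? (proj₁ x ≟ proj₁ y)
  ; ~-sym = λ i≢j j≡i → i≢j (sym j≡i)
  ; ~-irr = λ { refl i≢i → i≢i refl }
  }

KroneckerProduct : Graph → Graph → Graph
KroneckerProduct G H = record
  { V     = G.V × H.V
  ; order = G.order * H.order
  ; enum  = ↔-sym *↔× ↔-∘ (G.enum ×-↔ H.enum)
  ; _~_   = λ x y → (proj₁ x G.~ proj₁ y) × (proj₂ x H.~ proj₂ y)
  ; _~?_  = λ x y → (proj₁ x G.~? proj₁ y) ×-dec (proj₂ x H.~? proj₂ y)
  ; ~-sym = λ { (p , q) → G.~-sym p , H.~-sym q }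
  ; ~-irr = λ { refl (p , _) → G.~-irr refl p }
  }
  where
  module G = Graph G
  module H = Graph H

-- The ceiling of a / k is a nonnegative integer, so ∣_∣ only moves it from ℤ to ℕ.
⌈_/_⌉ : (a k : ℕ) .{{_ : NonZero k}} → ℕ
⌈ a / k ⌉ = ∣ ℚᵘ.ceiling (+ a ℚᵘ./ k) ∣

Admissible : ∀ {r} → (Fin r → ℕ) → ℕ → Pred ℕ 0ℓ
Admissible m n k = Σ[ k≥2 ∈ 2 ≤ k ] (∀ i →
  let instance
        k≢0   = >-nonZero (m<n⇒0<n k≥2)
        k∸1≢0 = >-nonZero (m<n⇒0<n∸m k≥2)
  in (+ (m i * n) ℚᵘ./ (k ∸ 1)) ℚᵘ.≥ (+ ⌈ m i * n / k ⌉ ℚᵘ./ 1))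

{-# OPTIONS --safe #-}

-- An independent set of K_{m₁,…,m_r} × K_n meeting two parts lies in a single
-- copy of K_{m₁,…,m_r}, so it has at most m ≤ n vertices.  Hence in an equitable
-- coloring either every class has at most n + 1 vertices, which forces at
-- least m colors, or every class has more than n vertices and lies inside one
-- part; then each part is split into classes of sizes t and t + 1, so t + 1 is
-- admissible and t + 1 ≤ h.  Since n + 1 is always admissible, h ≥ n + 1, and
-- both bounds dominate ∑ ⌈mᵢn/h⌉.  Conversely, h being admissible says exactly
-- that part i splits into ⌈mᵢn/h⌉ classes of sizes h − 1 and h.
module Submission where

open import Defs
open import Data.Nat.Base using (ℕ; _≤_; _<_; _*_; NonZero)
open import Data.Fin.Base using (Fin)
open import Data.Product.Base using (Σ-syntax; ∃-syntax; _×_)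

open import Algebra.Properties.CommutativeMonoid.Sum using (sum-cong-≗; ∑-comm)
open import Algebra.Properties.Semiring.Sum using (*-distribʳ-sum)
open import Data.Bool.Base using (true; false; if_then_else_)
open import Data.Fin.Base using (zero; suc; _↑ˡ_; _↑ʳ_; combine; remQuot; quotient; inject≤; splitAt)
open import Data.Fin.Properties
  using (_≟_; any?; all?; suc-injective; remQuot-combine; splitAt-↑ˡ; splitAt-↑ʳ; inject≤-injective)
import Data.Integer.Base as ℤ
import Data.Integer.Properties as ℤ
open import Data.List.Base using (length; filter; tabulate)
open import Data.Nat.Base
  using (zero; suc; _+_; _∸_; ∣_-_∣; _/_; _%_; z≤n; s≤s; s≤s⁻¹; z<s)
open import Data.Nat.DivMod using (m≡m%n+[m/n]*n; m%n<n)
open import Data.Nat.Properties hiding (_≟_; suc-injective)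
open import Data.Product.Base using (_,_; proj₁; proj₂; ∃)
open import Data.Rational.Unnormalised.Base as ℚᵘ using (*≤*)
import Data.Rational.Unnormalised.Properties as ℚᵘ
open import Data.Sum.Base using (_⊎_; inj₁; inj₂; [_,_]′)
open import Function.Base using (_∘_)
open import Function.Bundles using (Inverse)
open import Relation.Binary.PropositionalEquality
open import Relation.Nullary using (Dec; yes; no; does; ¬_; contradiction)
open import Relation.Nullary.Decidable using (¬?; _×-dec_; map′; decidable-stable)
open import Relation.Unary using (Pred; Decidable)

private variable
  a b : ℕ
  P Q : Set

-- Indicators and finite sums over `Fin`.

⟦_⟧ : Dec P → ℕ
⟦ P? ⟧ = if does P? then 1 else 0

⟦⟧≤1 : (P? : Dec P) → ⟦ P? ⟧ ≤ 1
⟦⟧≤1 (yes _) = ≤-refl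
⟦⟧≤1 (no _)  = z≤n

⟦⟧≡1 : (P? : Dec P) → P → ⟦ P? ⟧ ≡ 1
⟦⟧≡1 (yes _) _ = refl
⟦⟧≡1 (no ¬p) p = contradiction p ¬p

⟦⟧≡0 : (P? : Dec P) → ¬ P → ⟦ P? ⟧ ≡ 0
⟦⟧≡0 (yes p) ¬p = contradiction p ¬p
⟦⟧≡0 (no _)  _  = refl

⟦⟧-cong : (P? : Dec P) (Q? : Dec Q) → (P → Q) → (Q → P) → ⟦ P? ⟧ ≡ ⟦ Q? ⟧
⟦⟧-cong (yes p) Q? P⇒Q Q⇒P = sym (⟦⟧≡1 Q? (P⇒Q p))
⟦⟧-cong (no ¬p) Q? P⇒Q Q⇒P = sym (⟦⟧≡0 Q? (¬p ∘ Q⇒P))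

length-filter-tabulate : ∀ {ℓ} {A : Set} {P : Pred A ℓ} (P? : Decidable P) (f : Fin a → A) →
  length (filter P? (tabulate f)) ≡ sum (λ i → if does (P? (f i)) then 1 else 0)
length-filter-tabulate {zero}  P? f = refl
length-filter-tabulate {suc a} P? f with does (P? (f zero))
... | true  = cong suc (length-filter-tabulate P? (f ∘ suc))
... | false = length-filter-tabulate P? (f ∘ suc)

∑-cong : {f g : Fin a → ℕ} → f ≗ g → sum f ≡ sum g
∑-cong = sum-cong-≗ +-0-commutativeMonoid

∑-mono-≤ : {f g : Fin a → ℕ} → (∀ i → f i ≤ g i) → sum f ≤ sum g
∑-mono-≤ {zero}  f≤g = z≤n
∑-mono-≤ {suc a} f≤g = +-mono-≤ (f≤g zero) (∑-mono-≤ (f≤g ∘ suc))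

∑-const : ∀ a c → sum {a} (λ _ → c) ≡ a * c
∑-const zero    c = refl
∑-const (suc a) c = cong (c +_) (∑-const a c)

∑-*ʳ : (f : Fin a → ℕ) (c : ℕ) → sum (λ i → f i * c) ≡ sum f * c
∑-*ʳ f c = sym (*-distribʳ-sum +-*-semiring c f)

∑-zero : {f : Fin a → ℕ} → (∀ i → f i ≡ 0) → sum f ≡ 0
∑-zero {a} f≡0 = trans (∑-cong f≡0) (trans (∑-const a 0) (*-zeroʳ a))

∑-at : {f : Fin a → ℕ} (i : Fin a) → (∀ j → j ≢ i → f j ≡ 0) → sum f ≡ f i
∑-at {suc a} {f} zero f≡0 =
  trans (cong (f zero +_) (∑-zero λ j → f≡0 (suc j) λ ())) (+-identityʳ _)
∑-at {suc a} {f} (suc i) f≡0 =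
  trans (cong (_+ sum (f ∘ suc)) (f≡0 zero λ ()))
        (∑-at i λ j j≢i → f≡0 (suc j) (j≢i ∘ suc-injective))

∑⟦⟧≡1 : (i : Fin a) → sum (λ j → ⟦ i ≟ j ⟧) ≡ 1
∑⟦⟧≡1 i = trans (∑-at i λ j j≢i → ⟦⟧≡0 (i ≟ j) (j≢i ∘ sym)) (⟦⟧≡1 (i ≟ i) refl)

∑⟦⟧≤1 : {P : Pred (Fin a) _} (P? : Decidable P) → (∀ i j → P i → P j → i ≡ j) →
        sum (λ i → ⟦ P? i ⟧) ≤ 1
∑⟦⟧≤1 P? unique with any? P?
... | no ∄P = ≤-trans (≤-reflexive (∑-zero λ i → ⟦⟧≡0 (P? i) λ p → ∄P (i , p))) z≤n
... | yes (i , p) = ≤-trans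
  (≤-reflexive (∑-at i λ j j≢i → ⟦⟧≡0 (P? j) λ q → j≢i (unique j i q p))) (⟦⟧≤1 (P? i))

∑-+ : ∀ a (f : Fin (a + b) → ℕ) → sum f ≡ sum (f ∘ (_↑ˡ b)) + sum (f ∘ (a ↑ʳ_))
∑-+ zero    f = refl
∑-+ (suc a) f = trans (cong (f zero +_) (∑-+ a (f ∘ suc))) (sym (+-assoc (f zero) _ _))

∑-× : ∀ a b (f : Fin (a * b) → ℕ) → sum f ≡ sum λ i → sum λ j → f (combine {a} {b} i j)
∑-× zero    b f = refl
∑-× (suc a) b f = trans (∑-+ b f) (cong (sum (f ∘ (_↑ˡ (a * b))) +_) (∑-× a b (f ∘ (b ↑ʳ_))))

-- The bijection `ΣFin↔sum` reduces to `_↑ˡ_` on the first summand and to `_↑ʳ_` on the others, so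
-- the induction needs no rewriting.
∑-Σ : ∀ {r} (m : Fin r → ℕ) (f : Fin (sum m) → ℕ) →
      sum f ≡ sum λ i → sum λ x → f (Inverse.to (ΣFin↔sum m) (i , x))
∑-Σ {zero}  m f = refl
∑-Σ {suc r} m f = trans (∑-+ (m zero) f)
  (cong (sum (f ∘ (_↑ˡ sum (m ∘ suc))) +_) (∑-Σ (m ∘ suc) (f ∘ (m zero ↑ʳ_))))

-- Families of numbers with pairwise differences at most 1.

within-1 : ∀ {t} x y → t ≤ x → x ≤ suc t → t ≤ y → y ≤ suc t → ∣ x - y ∣ ≤ 1
within-1 {t} x y t≤x x≤1+t t≤y y≤1+t with ≤-total x y
... | inj₁ x≤y = ≤-trans (≤-reflexive (m≤n⇒∣m-n∣≡n∸m x≤y))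
  (m≤n+o⇒m∸n≤o y x (≤-trans y≤1+t (≤-trans (s≤s t≤x) (≤-reflexive (+-comm 1 x)))))
... | inj₂ y≤x = ≤-trans (≤-reflexive (m≤n⇒∣n-m∣≡n∸m y≤x))
  (m≤n+o⇒m∸n≤o x y (≤-trans x≤1+t (≤-trans (s≤s t≤y) (≤-reflexive (+-comm 1 y)))))

-- If some value exceeds `f i`, then `f i` is the minimum and serves as `t`; otherwise `f i` is the
-- maximum and `t` is its predecessor. In the second case `l < f i` still leaves `l ≤ t`.
two-values : ∀ (f : Fin a → ℕ) → (∀ i j → ∣ f i - f j ∣ ≤ 1) → ∀ i {l} → l < f i →
             ∃[ t ] l ≤ t × (∀ j → t ≤ f j × f j ≤ suc t)
two-values f close i l<fi = extremes (any? λ j → f i <? f j) (f i) refl l<fi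
  where
  near : ∀ x y → f x ≤ suc (f y)
  near x y = ≤-trans (m≤∣m-n∣+n (f x) (f y)) (+-monoˡ-≤ (f y) (close x y))

  extremes : ∀ {l} → Dec (∃[ j ] f i < f j) → ∀ fi → f i ≡ fi → l < fi →
             ∃[ t ] l ≤ t × (∀ j → t ≤ f j × f j ≤ suc t)
  extremes (yes (j , fi<fj)) _ refl l<fi =
    f i , <⇒≤ l<fi , λ k → s≤s⁻¹ (≤-trans fi<fj (near j k)) , near k i
  extremes (no ∄j) (suc t) fi≡ l<fi =
    t , s≤s⁻¹ l<fi , λ k → s≤s⁻¹ (subst (_≤ suc (f k)) fi≡ (near i k)) ,
      subst (f k ≤_) fi≡ (≮⇒≥ λ fi<fk → ∄j (k , fi<fk))

-- Equitable maps

-- The first `c * t` elements form `c` blocks of length `t`. The remaining `e` are sent injectively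
-- to the colors and so enlarge each class by at most one.
equitable-map-+ : ∀ c t e → e ≤ c →
  Σ[ g ∈ (Fin (c * t + e) → Fin c) ] (∀ d →
    t ≤ sum (λ x → ⟦ g x ≟ d ⟧) × sum (λ x → ⟦ g x ≟ d ⟧) ≤ suc t)
equitable-map-+ c t e e≤c = g , λ d →
    ≤-trans (m≤m+n t _) (≤-reflexive (sym (size d)))
  , ≤-trans (≤-reflexive (size d)) (≤-trans (+-monoʳ-≤ t (rest d)) (≤-reflexive (+-comm t 1)))
  where
  split : Fin (c * t) ⊎ Fin e → Fin c
  split = [ quotient t , (λ y → inject≤ y e≤c) ]′

  g : Fin (c * t + e) → Fin c
  g = split ∘ splitAt (c * t)

  rest : ∀ d → sum (λ y → ⟦ inject≤ {e} y e≤c ≟ d ⟧) ≤ 1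
  rest d = ∑⟦⟧≤1 (λ y → inject≤ y e≤c ≟ d) λ i j i≡d j≡d →
    inject≤-injective e≤c e≤c i j (trans i≡d (sym j≡d))

  quotient-combine : ∀ i j → quotient t (combine {c} {t} i j) ≡ i
  quotient-combine i j = cong proj₁ (remQuot-combine i j)

  open ≡-Reasoning
  blocks : ∀ d → sum (λ x → ⟦ quotient {c} t x ≟ d ⟧) ≡ t
  blocks d = begin
    sum (λ x → ⟦ quotient {c} t x ≟ d ⟧)
      ≡⟨ ∑-× c t _ ⟩
    sum (λ i → sum λ j → ⟦ quotient t (combine {c} {t} i j) ≟ d ⟧)
      ≡⟨ (∑-cong λ i → ∑-cong λ j → cong (λ q → ⟦ q ≟ d ⟧) (quotient-combine i j)) ⟩
    sum (λ i → sum λ (_ : Fin t) → ⟦ i ≟ d ⟧)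
      ≡⟨ (∑-at d λ i i≢d → ∑-zero {t} λ _ → ⟦⟧≡0 (i ≟ d) i≢d) ⟩
    sum (λ (_ : Fin t) → ⟦ d ≟ d ⟧)
      ≡⟨ ∑-const t _ ⟩
    t * ⟦ d ≟ d ⟧
      ≡⟨ cong (t *_) (⟦⟧≡1 (d ≟ d) refl) ⟩
    t * 1
      ≡⟨ *-identityʳ t ⟩
    t ∎

  size : ∀ d → sum (λ x → ⟦ g x ≟ d ⟧) ≡ t + sum (λ y → ⟦ inject≤ {e} y e≤c ≟ d ⟧)
  size d = begin
    sum (λ x → ⟦ g x ≟ d ⟧)
      ≡⟨ ∑-+ (c * t) _ ⟩
    sum (λ x → ⟦ g (x ↑ˡ e) ≟ d ⟧) + sum (λ y → ⟦ g (c * t ↑ʳ y) ≟ d ⟧)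
      ≡⟨ cong₂ _+_
           (∑-cong λ x → cong (λ s → ⟦ split s ≟ d ⟧) (splitAt-↑ˡ (c * t) x e))
           (∑-cong λ y → cong (λ s → ⟦ split s ≟ d ⟧) (splitAt-↑ʳ (c * t) e y)) ⟩
    sum (λ x → ⟦ quotient {c} t x ≟ d ⟧) + sum (λ y → ⟦ inject≤ {e} y e≤c ≟ d ⟧)
      ≡⟨ cong (_+ sum (λ y → ⟦ inject≤ {e} y e≤c ≟ d ⟧)) (blocks d) ⟩
    t + sum (λ y → ⟦ inject≤ {e} y e≤c ≟ d ⟧) ∎

equitable-map : ∀ {N} c t → c * t ≤ N → N ≤ c * suc t →
  Σ[ g ∈ (Fin N → Fin c) ] (∀ d →
    t ≤ sum (λ x → ⟦ g x ≟ d ⟧) × sum (λ x → ⟦ g x ≟ d ⟧) ≤ suc t)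
equitable-map {N} c t ct≤N N≤c[1+t] =
  subst (λ N → Σ[ g ∈ (Fin N → Fin c) ] (∀ d →
           t ≤ sum (λ x → ⟦ g x ≟ d ⟧) × sum (λ x → ⟦ g x ≟ d ⟧) ≤ suc t))
        (m+[n∸m]≡n ct≤N)
        (equitable-map-+ c t (N ∸ c * t) (m≤n+o⇒m∸n≤o N (c * t)
          (≤-trans N≤c[1+t] (≤-reflexive (trans (*-suc c t) (+-comm c (c * t)))))))

-- Ceilings and admissibility

-- A ceiling is the negated floor of the negated fraction. The absolute value absorbs the outer
-- sign, and the factor `1ℤ` is the sign of the divisor.
⌈/⌉≡∣/ℕ∣ : ∀ a d → ⌈ a / suc d ⌉ ≡ ℤ.∣ (ℤ.- (ℤ.+ a)) ℤ./ℕ suc d ∣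
⌈/⌉≡∣/ℕ∣ zero    d = refl
⌈/⌉≡∣/ℕ∣ (suc a) d = trans (ℤ.∣-i∣≡∣i∣ (ℤ.1ℤ ℤ.* q)) (cong ℤ.∣_∣ (ℤ.*-identityˡ q))
  where
  q : ℤ.ℤ
  q = ℤ.-[1+ a ] ℤ./ℕ suc d

-- These two inequalities determine the ceiling; all later arguments know it only through them.
⌈/⌉-spec : ∀ a d → a ≤ ⌈ a / suc d ⌉ * suc d × ⌈ a / suc d ⌉ * suc d < a + suc d
⌈/⌉-spec zero    d = z≤n , z<s
⌈/⌉-spec (suc a) d rewrite ⌈/⌉≡∣/ℕ∣ (suc a) d
  -- Floor division of `-[1+ a ]` branches on this remainder: in absolute value it is
  -- `suc a / suc d` if the remainder is zero, and one more otherwise.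
  with suc a % suc d | m≡m%n+[m/n]*n (suc a) (suc d) | m%n<n (suc a) (suc d)
... | zero  | eq | _ rewrite ℤ.∣-i∣≡∣i∣ (ℤ.+ (suc a / suc d)) | sym eq = ≤-refl , m<m+n (suc a) z<s
... | suc x | eq | x<d =
    ≤-trans (≤-reflexive eq) (+-monoˡ-≤ _ (<⇒≤ x<d))
  , (begin-strict
    suc d + q * suc d            <⟨ +-monoʳ-< (suc d) (m<n+m (q * suc d) z<s) ⟩
    suc d + (suc x + q * suc d)  ≡⟨ cong (suc d +_) eq ⟨
    suc d + suc a                ≡⟨ +-comm (suc d) (suc a) ⟩
    suc a + suc d                ∎)
  where
  open ≤-Reasoning
  q : ℕ
  q = suc a / suc d

⌈/⌉-≤ : ∀ {a c} d → a ≤ c * suc d → ⌈ a / suc d ⌉ ≤ c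
⌈/⌉-≤ {a} {c} d a≤cd = m<1+n⇒m≤n (*-cancelʳ-< (suc d) _ (suc c)
  (<-≤-trans (proj₂ (⌈/⌉-spec a d))
    (≤-trans (+-monoˡ-≤ (suc d) a≤cd) (≤-reflexive (+-comm (c * suc d) (suc d))))))

module _ {r : ℕ} (m : Fin r → ℕ) (n : ℕ) where

  -- The upper bound puts the ceiling below `c i`; the lower bound then gives
  -- `⌈ m i * n / suc t ⌉ * t ≤ m i * n`, which is the rational inequality with denominators
  -- cleared.
  admissible⁺ : ∀ {t} → 1 ≤ t → (c : Fin r → ℕ) →
    (∀ i → c i * t ≤ m i * n × m i * n ≤ c i * suc t) → Admissible m n (suc t)
  admissible⁺ {suc t} _ c bounds = s≤s (s≤s z≤n) , λ i →
    *≤* (subst₂ ℤ._≤_ (ℤ.pos-* ⌈ m i * n / suc (suc t) ⌉ (suc t)) (sym (ℤ.*-identityʳ _))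
      (ℤ.+≤+ (≤-trans (*-monoˡ-≤ (suc t) (⌈/⌉-≤ {c = c i} (suc t) (proj₂ (bounds i)))) (proj₁ (bounds i)))))

  admissible⁻ : ∀ {t} → Admissible m n (suc t) → ∀ i → ⌈ m i * n / suc t ⌉ * t ≤ m i * n
  admissible⁻ {suc t} (s≤s (s≤s z≤n) , bound) i with bound i
  ... | *≤* le = ℤ.drop‿+≤+ (subst₂ ℤ._≤_ (sym (ℤ.pos-* ⌈ m i * n / suc (suc t) ⌉ (suc t))) (ℤ.*-identityʳ _) le)

  -- The ceiling of a positive fraction is at least 1, so admissibility bounds `t` by `m i * n`.
  -- This is what makes a greatest admissible number exist.
  admissible-bound : ∀ {k} i → 0 < m i * n → Admissible m n k → k ≤ suc (m i * n)
  admissible-bound {suc t} i 0<mn adm = s≤s (begin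
    t                       ≡⟨ *-identityˡ t ⟨
    1 * t                   ≤⟨ *-monoˡ-≤ t (n≢0⇒n>0 ⌈mn/1+t⌉≢0) ⟩
    ⌈ m i * n / suc t ⌉ * t ≤⟨ admissible⁻ adm i ⟩
    m i * n                 ∎)
    where
    open ≤-Reasoning
    ⌈mn/1+t⌉≢0 : ⌈ m i * n / suc t ⌉ ≢ 0
    ⌈mn/1+t⌉≢0 eq = <⇒≱ 0<mn (subst (λ c → m i * n ≤ c * suc t) eq (proj₁ (⌈/⌉-spec (m i * n) t)))

  -- Part `i` splits into `m i` classes of size exactly `n`.
  1+n-admissible : 0 < n → Admissible m n (suc n)
  1+n-admissible 0<n = admissible⁺ 0<n m λ i → ≤-refl , *-monoʳ-≤ (m i) (n≤1+n n)

  admissible? : Decidable (Admissible m n)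
  admissible? k with 2 ≤? k
  ... | no 2≰k  = no (2≰k ∘ proj₁)
  ... | yes 2≤k = map′ (2≤k ,_)
    -- The inequalities are stated relative to a proof of `2 ≤ k`, and any two such proofs are
    -- equal.
    (λ { (2≤k′ , bound) → subst _ (≤-irrelevant 2≤k′ 2≤k) bound })
    (all? λ i → _ ℚᵘ.≤? _)

greatest : {P : Pred ℕ _} → Decidable P → ∀ b → (∀ j → P j → j ≤ b) → ∃ P → ∃ (IsGreatest P)
greatest P? zero P≤0 (k , Pk) with P≤0 k Pk
... | z≤n = 0 , Pk , P≤0
greatest P? (suc b) P≤1+b ∃P with P? (suc b)
... | yes p = suc b , p , P≤1+b
... | no ¬p = greatest P? b
  (λ j Pj → m<1+n⇒m≤n (≤∧≢⇒< (P≤1+b j Pj) λ { refl → ¬p Pj })) ∃P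

-- Counting vertices of the Kronecker product by part and color.

module _ {r : ℕ} (m : Fin r → ℕ) (n : ℕ) where

  private
    G : Graph
    G = KroneckerProduct (CompleteMultipartite m) (Complete n)

    open Graph G using (V; _~_; enum)

  ∑-vertices : (F : V → ℕ) →
    sum (F ∘ Inverse.from enum) ≡ sum λ i → sum λ x → sum λ y → F ((i , x) , y)
  ∑-vertices F = begin
    sum (F ∘ Inverse.from enum)
      ≡⟨ ∑-× (sum m) n (F ∘ Inverse.from enum) ⟩
    sum (λ k → sum λ y → F (vertex (remQuot n (combine {sum m} k y))))
      ≡⟨ (∑-cong λ k → ∑-cong λ y → cong (F ∘ vertex) (remQuot-combine {sum m} k y)) ⟩
    sum (λ k → sum λ y → F (Inverse.from (ΣFin↔sum m) k , y))
      ≡⟨ ∑-Σ m _ ⟩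
    sum (λ i → sum λ x → sum λ y → F (Inverse.from (ΣFin↔sum m) (Inverse.to (ΣFin↔sum m) (i , x)) , y))
      ≡⟨ (∑-cong λ i → ∑-cong λ x → ∑-cong λ y →
            cong (λ v → F (v , y)) (Inverse.strictlyInverseʳ (ΣFin↔sum m) (i , x))) ⟩
    sum (λ i → sum λ x → sum λ y → F ((i , x) , y)) ∎
    where
    open ≡-Reasoning
    vertex : Fin (sum m) × Fin n → V
    vertex (k , y) = Inverse.from (ΣFin↔sum m) k , y

  partCount : ∀ {k} → (V → Fin k) → Fin k → Fin r → ℕ
  partCount f c i = sum λ x → sum λ y → ⟦ f ((i , x) , y) ≟ c ⟧

  length-colorClass : ∀ {k} (f : V → Fin k) c → length (colorClass G f c) ≡ sum (partCount f c)
  length-colorClass f c =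
    trans (length-filter-tabulate (λ v → f v ≟ c) (Inverse.from enum)) (∑-vertices λ v → ⟦ f v ≟ c ⟧)

  ∑-partCount : ∀ {k} (f : V → Fin k) i → sum (λ c → partCount f c i) ≡ m i * n
  ∑-partCount f i = begin
    sum (λ c → partCount f c i)
      ≡⟨ ∑-comm +-0-commutativeMonoid (λ c x → sum λ y → ⟦ f ((i , x) , y) ≟ c ⟧) ⟩
    sum (λ x → sum λ c → sum λ y → ⟦ f ((i , x) , y) ≟ c ⟧)
      ≡⟨ (∑-cong λ x → trans (∑-comm +-0-commutativeMonoid λ c y → ⟦ f ((i , x) , y) ≟ c ⟧)
                             (∑-cong λ y → ∑⟦⟧≡1 (f ((i , x) , y)))) ⟩
    sum (λ (_ : Fin (m i)) → sum {n} λ _ → 1)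
      ≡⟨ ∑-const (m i) _ ⟩
    m i * sum {n} (λ _ → 1)
      ≡⟨ cong (m i *_) (trans (∑-const n 1) (*-identityʳ n)) ⟩
    m i * n ∎
    where open ≡-Reasoning

  -- Upper bound: coloring each part separately.

  equitablyColorable : ∀ t (c : Fin r → ℕ) →
    (∀ i → c i * t ≤ m i * n × m i * n ≤ c i * suc t) → EquitablyColorable G (sum c)
  equitablyColorable t c bounds = f , proper , equitable
    where
    g : ∀ i → Fin (m i * n) → Fin (c i)
    g i = proj₁ (equitable-map (c i) t (proj₁ (bounds i)) (proj₂ (bounds i)))

    g-size : ∀ i d → t ≤ sum (λ x → ⟦ g i x ≟ d ⟧) × sum (λ x → ⟦ g i x ≟ d ⟧) ≤ suc t
    g-size i = proj₂ (equitable-map (c i) t (proj₁ (bounds i)) (proj₂ (bounds i)))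

    open Inverse (ΣFin↔sum c) using (to; from; strictlyInverseˡ; strictlyInverseʳ)

    to-injective : ∀ {u v} → to u ≡ to v → u ≡ v
    to-injective {u} {v} eq =
      trans (sym (strictlyInverseʳ u)) (trans (cong from eq) (strictlyInverseʳ v))

    -- A color encodes a part together with a class inside it. Equal colors force equal parts, and
    -- vertices of the same part are never adjacent.
    f : V → Fin (sum c)
    f ((i , x) , y) = to (i , g i (combine {m i} x y))

    proper : IsColoring G f
    proper (i≢j , _) eq = i≢j (cong proj₁ (to-injective eq))

    size : ∀ i d → length (colorClass G f (to (i , d))) ≡ sum (λ x → ⟦ g i x ≟ d ⟧)
    size i d = begin
      length (colorClass G f (to (i , d)))
        ≡⟨ length-colorClass f _ ⟩
      sum (partCount f (to (i , d)))
        ≡⟨ (∑-at i λ j j≢i → ∑-zero λ x → ∑-zero λ y →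
              ⟦⟧≡0 (f ((j , x) , y) ≟ _) (j≢i ∘ cong proj₁ ∘ to-injective)) ⟩
      partCount f (to (i , d)) i
        ≡⟨ (∑-cong λ x → ∑-cong λ y → ⟦⟧-cong (f ((i , x) , y) ≟ _) (g i (combine {m i} x y) ≟ d)
              (λ eq → same (to-injective eq)) (cong (λ e → to (i , e)))) ⟩
      sum (λ x → sum λ y → ⟦ g i (combine {m i} x y) ≟ d ⟧)
        ≡⟨ ∑-× (m i) n (λ x → ⟦ g i x ≟ d ⟧) ⟨
      sum (λ x → ⟦ g i x ≟ d ⟧) ∎
      where
      open ≡-Reasoning
      same : ∀ {d e : Fin (c i)} → (i , d) ≡ (i , e) → d ≡ e
      same refl = refl

    bounded : ∀ d → t ≤ length (colorClass G f d) × length (colorClass G f d) ≤ suc t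
    bounded d = subst (λ d → t ≤ length (colorClass G f d) × length (colorClass G f d) ≤ suc t)
      (strictlyInverseˡ d)
      (let i , e = from d in
       ≤-trans (proj₁ (g-size i e)) (≤-reflexive (sym (size i e))) ,
       ≤-trans (≤-reflexive (size i e)) (proj₂ (g-size i e)))

    equitable : IsEquitable G f
    equitable d e = within-1 _ _
      (proj₁ (bounded d)) (proj₂ (bounded d)) (proj₁ (bounded e)) (proj₂ (bounded e))

  ∑-order : sum (λ i → m i * n) ≡ sum m * n
  ∑-order = ∑-*ʳ m n

  -- Lower bound: the structure of equitable colorings.

  module _ {k} (f : V → Fin k) (proper : IsColoring G f) where

    -- Some vertex x of K_{m₁,…,m_r} occurs twice in the class, with second
    -- coordinates y₁ ≠ y₂; a vertex of another part is adjacent to one of the two.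
    large-class-in-part : ∀ c → sum m < length (colorClass G f c) →
      ∃[ i ] (∀ v → f v ≡ c → proj₁ (proj₁ v) ≡ i)
    large-class-in-part c m<∣c∣ with any? (λ i → any? λ x → any? λ y₁ → any? λ y₂ →
      (f ((i , x) , y₁) ≟ c) ×-dec (f ((i , x) , y₂) ≟ c) ×-dec ¬? (y₁ ≟ y₂))
    ... | yes (i , x , y₁ , y₂ , f₁ , f₂ , y₁≢y₂) = i , same-part
      where
      same-part : ∀ v → f v ≡ c → proj₁ (proj₁ v) ≡ i
      same-part ((j , z) , y) fv = decidable-stable (j ≟ i) λ j≢i →
        let y≡ : ∀ {y′} → f ((i , x) , y′) ≡ c → y ≡ y′
            y≡ {y′} f′ = decidable-stable (y ≟ y′) λ y≢y′ →
              proper {(j , z) , y} {(i , x) , y′} (j≢i , y≢y′) (trans fv (sym f′))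
        in y₁≢y₂ (trans (sym (y≡ f₁)) (y≡ f₂))
    -- Otherwise each of the `sum m` first coordinates occurs at most once in the class.
    ... | no ∄ = contradiction m<∣c∣ (≤⇒≯ (begin
      length (colorClass G f c)     ≡⟨ length-colorClass f c ⟩
      sum (partCount f c)           ≤⟨ (∑-mono-≤ λ i → ∑-mono-≤ λ x → ∑⟦⟧≤1 (λ y → f ((i , x) , y) ≟ c)
                                          λ y₁ y₂ f₁ f₂ → decidable-stable (y₁ ≟ y₂)
                                            λ y₁≢y₂ → ∄ (i , x , y₁ , y₂ , f₁ , f₂ , y₁≢y₂)) ⟩
      sum (λ i → sum {m i} λ _ → 1) ≡⟨ (∑-cong λ i → trans (∑-const (m i) 1) (*-identityʳ (m i))) ⟩
      sum m                         ∎))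
      where open ≤-Reasoning

    -- Every class is large enough to lie inside one part, so the `m i * n` vertices of part `i` are
    -- partitioned by the classes in it. `C i` counts these classes, each of size `t` or `suc t`.
    large-classes-refine-parts : ∀ {t} → sum m < t →
      (∀ c → t ≤ length (colorClass G f c) × length (colorClass G f c) ≤ suc t) →
      Σ[ C ∈ (Fin r → ℕ) ] sum C ≡ k × (∀ i → C i * t ≤ m i * n × m i * n ≤ C i * suc t)
    large-classes-refine-parts {t} m<t size = C , ∑C≡k , bounds
      where
      in-part : ∀ c → ∃[ i ] (∀ v → f v ≡ c → proj₁ (proj₁ v) ≡ i)
      in-part c = large-class-in-part c (<-≤-trans m<t (proj₁ (size c)))

      part : Fin k → Fin r
      part c = proj₁ (in-part c)

      C : Fin r → ℕ
      C i = sum λ c → ⟦ part c ≟ i ⟧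

      ∑C≡k : sum C ≡ k
      ∑C≡k = trans (∑-comm +-0-commutativeMonoid λ i c → ⟦ part c ≟ i ⟧)
        (trans (∑-cong (∑⟦⟧≡1 ∘ part)) (trans (∑-const k 1) (*-identityʳ k)))

      off-part : ∀ c i → i ≢ part c → partCount f c i ≡ 0
      off-part c i i≢ = ∑-zero λ x → ∑-zero λ y →
        ⟦⟧≡0 (f ((i , x) , y) ≟ c) (i≢ ∘ proj₂ (in-part c) _)

      on-part : ∀ c → length (colorClass G f c) ≡ partCount f c (part c)
      on-part c = trans (length-colorClass f c) (∑-at (part c) (off-part c))

      count : ∀ c i → ⟦ part c ≟ i ⟧ * t ≤ partCount f c i × partCount f c i ≤ ⟦ part c ≟ i ⟧ * suc t
      count c i with part c ≟ i
      ... | no part≢i = z≤n , ≤-reflexive (off-part c i (part≢i ∘ sym))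
      ... | yes refl  =
          ≤-trans (≤-reflexive (*-identityˡ t)) (≤-trans (proj₁ (size c)) (≤-reflexive (on-part c)))
        , ≤-trans (≤-reflexive (sym (on-part c)))
                  (≤-trans (proj₂ (size c)) (≤-reflexive (sym (*-identityˡ (suc t)))))

      bounds : ∀ i → C i * t ≤ m i * n × m i * n ≤ C i * suc t
      bounds i = (begin
          C i * t                         ≡⟨ ∑-*ʳ (λ c → ⟦ part c ≟ i ⟧) t ⟨
          sum (λ c → ⟦ part c ≟ i ⟧ * t)  ≤⟨ (∑-mono-≤ λ c → proj₁ (count c i)) ⟩
          sum (λ c → partCount f c i)     ≡⟨ ∑-partCount f i ⟩
          m i * n                         ∎)
        , (begin
          m i * n                             ≡⟨ ∑-partCount f i ⟨
          sum (λ c → partCount f c i)         ≤⟨ (∑-mono-≤ λ c → proj₂ (count c i)) ⟩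
          sum (λ c → ⟦ part c ≟ i ⟧ * suc t)  ≡⟨ ∑-*ʳ (λ c → ⟦ part c ≟ i ⟧) (suc t) ⟩
          C i * suc t                         ∎)
        where open ≤-Reasoning

    -- If `k < sum m ≤ n`, the classes hold at most `k * suc n = k + k * n < suc k * n` vertices,
    -- fewer than the total `sum m * n`.
    small-classes⇒many : sum m ≤ n → (∀ c → length (colorClass G f c) ≤ suc n) → sum m ≤ k
    small-classes⇒many m≤n small = ≮⇒≥ λ k<m → <-irrefl refl (begin-strict
      sum m * n                                ≡⟨ ∑-order ⟨
      sum (λ i → m i * n)                      ≡⟨ ∑-cong (∑-partCount f) ⟨
      sum (λ i → sum λ c → partCount f c i)    ≡⟨ ∑-comm +-0-commutativeMonoid (λ i c → partCount f c i) ⟩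
      sum (λ c → sum (partCount f c))          ≡⟨ ∑-cong (length-colorClass f) ⟨
      sum (λ c → length (colorClass G f c))    ≤⟨ ∑-mono-≤ small ⟩
      sum {k} (λ _ → suc n)                    ≡⟨ ∑-const k (suc n) ⟩
      k * suc n                                ≡⟨ *-suc k n ⟩
      k + k * n                                <⟨ +-monoˡ-< (k * n) (<-≤-trans k<m m≤n) ⟩
      suc k * n                                ≤⟨ *-monoˡ-≤ n k<m ⟩
      sum m * n                                ∎)
      where open ≤-Reasoning

  equitable-coloring-classes : sum m ≤ n → ∀ {k} → EquitablyColorable G k →
    sum m ≤ k ⊎
    ∃[ t ] n < t × (Σ[ C ∈ (Fin r → ℕ) ] sum C ≡ k × (∀ i → C i * t ≤ m i * n × m i * n ≤ C i * suc t))
  equitable-coloring-classes m≤n (f , proper , equitable)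
    with any? (λ c → suc n <? length (colorClass G f c))
  ... | no ∄large = inj₁ (small-classes⇒many f proper m≤n λ c → ≮⇒≥ λ large → ∄large (c , large))
  ... | yes (c , large) =
    -- A class with more than `suc n` vertices forces `suc n ≤ t`, so every class has more than `n`
    -- and hence more than `sum m` vertices.
    let t , n<t , size = two-values (length ∘ colorClass G f) equitable c large
    in inj₂ (t , n<t , large-classes-refine-parts f proper (≤-<-trans m≤n n<t) size)

theorem3p1 : ∀ (r : ℕ) (m : Fin r → ℕ) (n : ℕ) →
    1 ≤ r → (∀ i → 0 < m i) → 0 < n → sum m ≤ n →
    ∃[ h ] Σ[ h≢0 ∈ NonZero h ]
    IsGreatest (Admissible m n) h ×
    (χ₌[ KroneckerProduct (CompleteMultipartite m) (Complete n) ]≡ (sum (λ i → ⌈_/_⌉ (m i * n) h {{h≢0}})))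
theorem3p1 (suc r) m n _ 0<m 0<n m≤n
  with greatest (admissible? m n) (suc (m zero * n))
         (λ _ → admissible-bound m n zero (*-mono-< (0<m zero) 0<n)) (suc n , 1+n-admissible m n 0<n)
... | zero , (() , _) , _
... | suc t , adm , maximal = suc t , _ , (adm , maximal) ,
    equitablyColorable m n t (λ i → ⌈ m i * n / suc t ⌉)
      (λ i → admissible⁻ m n adm i , proj₁ (⌈/⌉-spec (m i * n) t)) ,
    λ k colorable → [ ≤-trans (∑-mono-≤ ⌈mn/h⌉≤m) , refined k ]′
      (equitable-coloring-classes m n m≤n colorable)
  where
  ⌈mn/h⌉≤m : ∀ i → ⌈ m i * n / suc t ⌉ ≤ m i
  -- Maximality gives `n < h`, hence `m i * n ≤ m i * h`.
  ⌈mn/h⌉≤m i = ⌈/⌉-≤ t (*-monoʳ-≤ (m i) (<⇒≤ (maximal (suc n) (1+n-admissible m n 0<n))))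

  refined : ∀ k → (∃[ s ] n < s × (Σ[ C ∈ (Fin (suc r) → ℕ) ] sum C ≡ k ×
                     (∀ i → C i * s ≤ m i * n × m i * n ≤ C i * suc s))) →
            sum (λ i → ⌈ m i * n / suc t ⌉) ≤ k
  -- The splitting makes `suc s` admissible, so `suc s ≤ h` and `m i * n ≤ C i * h`; thus `C i`
  -- dominates the ceiling termwise.
  refined _ (s , n<s , C , refl , bounds) = ∑-mono-≤ λ i →
    ⌈/⌉-≤ {c = C i} t (≤-trans (proj₂ (bounds i)) (*-monoʳ-≤ (C i)
      (maximal (suc s) (admissible⁺ m n (≤-trans z<s n<s) C bounds))))
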